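{- Let $H$ and $V$ be endofunctors on $\mathcal A$ such that $H+V$ is iteratable, let $a:HA\to A$ be a completely iterative algebra for $H$, and let $e:V\to T^{H+V}$ be a guarded recursive program scheme with (unique) interpreted solution $e^\ddagger_A:VA\to A$ in $(A,a)$. Then the algebra $[a,e^\ddagger_A]:(H+V)A\to A$ is a completely iterative algebra for $H+V$.
   Context: $\mathcal A$ is a category with binary coproducts. For an endofunctor $G$, a flat equation morphism in an object $A$ is a morphism $e:X\to GX+A$; a $G$-algebra $a:GA\to A$ is a completely iterative algebra (cia) if every flat equation morphism $e:X\to GX+A$ has a unique solution, i.e. a unique $e^\dagger:X\to A$ with $e^\dagger=[a,\mathrm{id}_A]\cdot(Ge^\dagger+\mathrm{id}_A)\cdot e$. An endofunctor $G$ is iteratable if for each object $X$ a terminal coalgebra $T^GX$ for $G(-)+X$ exists; the inverse of its structure is written $[\tau^G_X,\eta^G_X]:GT^GX+X\to T^GX$. Then $T^G$ is a monad with unit $\eta^G$ and multiplication $\mu^G$, $(T^GX,\tau^G_X)$ is the free cia for $G$ on $X$, and $\kappa^G=\tau^G\cdot G\eta^G:G\to T^G$. A recursive program scheme (rps) is a natural transformation $e:V\to T^{H+V}$; it is guarded if $e=\tau^{H+V}\cdot(\mathrm{inl}\,T^{H+V})\cdot f$ for some natural transformation $f:V\to HT^{H+V}$, where $\mathrm{inl}:H\to H+V$ is the coproduct injection. Given a cia $(A,a)$ for $H$, an interpreted solution of $e$ in $A$ is a $V$-algebra $e^\ddagger_A:VA\to A$ for which there is an Eilenberg–Moore algebra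 $\beta:T^{H+V}A\to A$ for the monad $T^{H+V}$ with $\beta\cdot\kappa^{H+V}_A=[a,e^\ddagger_A]$ and $e^\ddagger_A=\beta\cdot e_A$. (Every guarded rps has a unique interpreted solution in every cia.) -}

module Defs where

open import Level using (Level; suc; _⊔_)
open import Data.Product using (Σ; _,_; proj₁; proj₂; ∃!)
open import Relation.Binary.Bundles using (Setoid)
open import Relation.Binary.Structures using (IsEquivalence)
import Relation.Binary.Reasoning.Setoid as SetoidReasoning

-- Categories are enriched in setoids: equality of morphisms is the relation
-- _≈_, and there is no equality of objects.
record Category (o ℓ q : Level) : Set (suc (o ⊔ ℓ ⊔ q)) where
  infix  4 _≈_ _⇒_
  infixr 9 _∘_
  field
    Obj       : Set o
    _⇒_       : Obj → Obj → Set ℓ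
    _≈_       : ∀ {A B} → A ⇒ B → A ⇒ B → Set q
    id        : ∀ {A} → A ⇒ A
    _∘_       : ∀ {A B C} → B ⇒ C → A ⇒ B → A ⇒ C
    equiv     : ∀ {A B} → IsEquivalence (_≈_ {A} {B})
    assoc     : ∀ {A B C D} {f : A ⇒ B} {g : B ⇒ C} {h : C ⇒ D} →
                (h ∘ g) ∘ f ≈ h ∘ (g ∘ f)
    identityˡ : ∀ {A B} {f : A ⇒ B} → id ∘ f ≈ f
    identityʳ : ∀ {A B} {f : A ⇒ B} → f ∘ id ≈ f
    ∘-resp-≈  : ∀ {A B C} {f h : B ⇒ C} {g i : A ⇒ B} →
                f ≈ h → g ≈ i → f ∘ g ≈ h ∘ i

  homSetoid : Obj → Obj → Setoid ℓ q
  homSetoid A B = record { Carrier = A ⇒ B ; _≈_ = _≈_ ; isEquivalence = equiv }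

  module Eq {A B : Obj} = IsEquivalence (equiv {A} {B})
  module HomReasoning {A B : Obj} = SetoidReasoning (homSetoid A B)

  ∘-congˡ : ∀ {A B C} {f : B ⇒ C} {g i : A ⇒ B} → g ≈ i → f ∘ g ≈ f ∘ i
  ∘-congˡ = ∘-resp-≈ Eq.refl

  ∘-congʳ : ∀ {A B C} {f h : B ⇒ C} {g : A ⇒ B} → f ≈ h → f ∘ g ≈ h ∘ g
  ∘-congʳ p = ∘-resp-≈ p Eq.refl

  pullˡ : ∀ {A B C D} {f : C ⇒ D} {g : B ⇒ C} {k : B ⇒ D} {h : A ⇒ B} →
          f ∘ g ≈ k → f ∘ (g ∘ h) ≈ k ∘ h
  pullˡ p = Eq.trans (Eq.sym assoc) (∘-congʳ p)

  pullʳ : ∀ {A B C D} {f : C ⇒ D} {g : B ⇒ C} {h : A ⇒ B} {k : A ⇒ C} →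
          g ∘ h ≈ k → (f ∘ g) ∘ h ≈ f ∘ k
  pullʳ p = Eq.trans assoc (∘-congˡ p)

record BinaryCoproducts {o ℓ q : Level} (𝒜 : Category o ℓ q) : Set (o ⊔ ℓ ⊔ q) where
  open Category 𝒜
  infixr 6 _+_
  field
    _+_     : Obj → Obj → Obj
    i₁      : ∀ {A B} → A ⇒ A + B
    i₂      : ∀ {A B} → B ⇒ A + B
    [_,_]   : ∀ {A B C} → A ⇒ C → B ⇒ C → A + B ⇒ C
    inject₁ : ∀ {A B C} {f : A ⇒ C} {g : B ⇒ C} → [ f , g ] ∘ i₁ ≈ f
    inject₂ : ∀ {A B C} {f : A ⇒ C} {g : B ⇒ C} → [ f , g ] ∘ i₂ ≈ g
    unique  : ∀ {A B C} {f : A ⇒ C} {g : B ⇒ C} {h : A + B ⇒ C} →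
              h ∘ i₁ ≈ f → h ∘ i₂ ≈ g → [ f , g ] ≈ h

  infixr 7 _+₁_
  _+₁_ : ∀ {A B C D} → A ⇒ C → B ⇒ D → A + B ⇒ C + D
  f +₁ g = [ i₁ ∘ f , i₂ ∘ g ]

  +-ext : ∀ {A B C} {h k : A + B ⇒ C} → h ∘ i₁ ≈ k ∘ i₁ → h ∘ i₂ ≈ k ∘ i₂ → h ≈ k
  +-ext p r = Eq.trans (Eq.sym (unique p r)) (unique Eq.refl Eq.refl)

  +₁-id : ∀ {A B} → id {A} +₁ id {B} ≈ id
  +₁-id = unique (Eq.trans identityˡ (Eq.sym identityʳ)) (Eq.trans identityˡ (Eq.sym identityʳ))

  +₁-∘ : ∀ {A B C A′ B′ C′} {f : A ⇒ B} {g : B ⇒ C} {f′ : A′ ⇒ B′} {g′ : B′ ⇒ C′} →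
         (g ∘ f) +₁ (g′ ∘ f′) ≈ (g +₁ g′) ∘ (f +₁ f′)
  +₁-∘ = unique
    (Eq.trans (pullʳ inject₁) (Eq.trans (pullˡ inject₁) assoc))
    (Eq.trans (pullʳ inject₂) (Eq.trans (pullˡ inject₂) assoc))

  +₁-resp-≈ : ∀ {A B C D} {f h : A ⇒ C} {g i : B ⇒ D} → f ≈ h → g ≈ i → f +₁ g ≈ h +₁ i
  +₁-resp-≈ p r = unique
    (Eq.trans inject₁ (∘-congˡ (Eq.sym p)))
    (Eq.trans inject₂ (∘-congˡ (Eq.sym r)))

module _ {o ℓ q : Level} (𝒜 : Category o ℓ q) where
  open Category 𝒜

  record Endofunctor : Set (o ⊔ ℓ ⊔ q) where
    field
      F₀           : Obj → Obj
      F₁           : ∀ {A B} → A ⇒ B → F₀ A ⇒ F₀ B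
      identity     : ∀ {A} → F₁ (id {A}) ≈ id
      homomorphism : ∀ {A B C} {f : A ⇒ B} {g : B ⇒ C} → F₁ (g ∘ f) ≈ F₁ g ∘ F₁ f
      F-resp-≈     : ∀ {A B} {f g : A ⇒ B} → f ≈ g → F₁ f ≈ F₁ g

module _ {o ℓ q : Level} {𝒜 : Category o ℓ q} where
  open Category 𝒜
  open Endofunctor

  record NaturalTransformation (F G : Endofunctor 𝒜) : Set (o ⊔ ℓ ⊔ q) where
    field
      component : ∀ X → F₀ F X ⇒ F₀ G X
      natural   : ∀ {X Y} (f : X ⇒ Y) → component Y ∘ F₁ F f ≈ F₁ G f ∘ component X

  Id : Endofunctor 𝒜
  Id = record
    { F₀ = λ X → X ; F₁ = λ f → f ; identity = Eq.refl ; homomorphism = Eq.refl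
    ; F-resp-≈ = λ p → p }

  Const : Obj → Endofunctor 𝒜
  Const A = record
    { F₀ = λ _ → A ; F₁ = λ _ → id ; identity = Eq.refl ; homomorphism = Eq.sym identityˡ
    ; F-resp-≈ = λ _ → Eq.refl }

  infixr 9 _∘F_
  _∘F_ : Endofunctor 𝒜 → Endofunctor 𝒜 → Endofunctor 𝒜
  G ∘F F = record
    { F₀           = λ X → F₀ G (F₀ F X)
    ; F₁           = λ f → F₁ G (F₁ F f)
    ; identity     = Eq.trans (F-resp-≈ G (identity F)) (identity G)
    ; homomorphism = Eq.trans (F-resp-≈ G (homomorphism F)) (homomorphism G)
    ; F-resp-≈     = λ p → F-resp-≈ G (F-resp-≈ F p)
    }

module _ {o ℓ q : Level} (𝒜 : Category o ℓ q) where
  open Category 𝒜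
  open Endofunctor
  open NaturalTransformation

  record Monad : Set (o ⊔ ℓ ⊔ q) where
    field
      T         : Endofunctor 𝒜
      η         : NaturalTransformation Id T
      μ         : NaturalTransformation (T ∘F T) T
      μ-assoc   : ∀ {X} → component μ X ∘ F₁ T (component μ X) ≈ component μ X ∘ component μ (F₀ T X)
      μ-unitˡ   : ∀ {X} → component μ X ∘ F₁ T (component η X) ≈ id
      μ-unitʳ   : ∀ {X} → component μ X ∘ component η (F₀ T X) ≈ id

module _ {o ℓ q : Level} {𝒜 : Category o ℓ q} where
  open Category 𝒜
  open Endofunctor
  open NaturalTransformation

  record IsEilenbergMoore (M : Monad 𝒜) {A : Obj} (β : F₀ (Monad.T M) A ⇒ A) : Set q where
    open Monad M
    field
      unit : β ∘ component η A ≈ id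
      mult : β ∘ component μ A ≈ β ∘ F₁ T β

  record TerminalCoalgebra (F : Endofunctor 𝒜) : Set (o ⊔ ℓ ⊔ q) where
    field
      carrier  : Obj
      out      : carrier ⇒ F₀ F carrier
      terminal : ∀ {X} (c : X ⇒ F₀ F X) → ∃! _≈_ λ (h : X ⇒ carrier) → out ∘ h ≈ F₁ F h ∘ c

    unfold : ∀ {X} → X ⇒ F₀ F X → X ⇒ carrier
    unfold c = proj₁ (terminal c)

    unfold-hom : ∀ {X} {c : X ⇒ F₀ F X} → out ∘ unfold c ≈ F₁ F (unfold c) ∘ c
    unfold-hom {c = c} = proj₁ (proj₂ (terminal c))

    hom-unique : ∀ {X} {c : X ⇒ F₀ F X} {h k : X ⇒ carrier} →
                 out ∘ h ≈ F₁ F h ∘ c → out ∘ k ≈ F₁ F k ∘ c → h ≈ k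
    hom-unique {c = c} p r =
      Eq.trans (Eq.sym (proj₂ (proj₂ (terminal c)) p)) (proj₂ (proj₂ (terminal c)) r)

    out⁻¹ : F₀ F carrier ⇒ carrier
    out⁻¹ = unfold (F₁ F out)

    out⁻¹-out : out⁻¹ ∘ out ≈ id
    out⁻¹-out = hom-unique
      (begin
        out ∘ (out⁻¹ ∘ out)             ≈⟨ pullˡ unfold-hom ⟩
        (F₁ F out⁻¹ ∘ F₁ F out) ∘ out   ≈⟨ ∘-congʳ (homomorphism F) ⟨
        F₁ F (out⁻¹ ∘ out) ∘ out        ∎)
      (Eq.trans identityʳ (Eq.sym (Eq.trans (∘-congʳ (identity F)) identityˡ)))
      where open HomReasoning

    out-out⁻¹ : out ∘ out⁻¹ ≈ id
    out-out⁻¹ = begin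
      out ∘ out⁻¹             ≈⟨ unfold-hom ⟩
      F₁ F out⁻¹ ∘ F₁ F out   ≈⟨ homomorphism F ⟨
      F₁ F (out⁻¹ ∘ out)      ≈⟨ F-resp-≈ F out⁻¹-out ⟩
      F₁ F id                 ≈⟨ identity F ⟩
      id                      ∎
      where open HomReasoning

    out-mono : ∀ {X} {h k : X ⇒ carrier} → out ∘ h ≈ out ∘ k → h ≈ k
    out-mono {h = h} {k} p = begin
      h                   ≈⟨ identityˡ ⟨
      id ∘ h              ≈⟨ ∘-congʳ out⁻¹-out ⟨
      (out⁻¹ ∘ out) ∘ h   ≈⟨ pullʳ p ⟩
      out⁻¹ ∘ (out ∘ k)   ≈⟨ pullˡ out⁻¹-out ⟩
      id ∘ k              ≈⟨ identityˡ ⟩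
      k                   ∎
      where open HomReasoning

    out⁻¹-epi : ∀ {X} {h k : carrier ⇒ X} → h ∘ out⁻¹ ≈ k ∘ out⁻¹ → h ≈ k
    out⁻¹-epi {h = h} {k} p = begin
      h                   ≈⟨ identityʳ ⟨
      h ∘ id              ≈⟨ ∘-congˡ out⁻¹-out ⟨
      h ∘ (out⁻¹ ∘ out)   ≈⟨ pullˡ p ⟩
      (k ∘ out⁻¹) ∘ out   ≈⟨ pullʳ out⁻¹-out ⟩
      k ∘ id              ≈⟨ identityʳ ⟩
      k                   ∎
      where open HomReasoning

module WithCoproducts {o ℓ q : Level} (𝒜 : Category o ℓ q) (coproducts : BinaryCoproducts 𝒜) where
  open Category 𝒜
  open BinaryCoproducts coproducts
  open Endofunctor
  open NaturalTransformation

  infixr 6 _⊕_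
  _⊕_ : Endofunctor 𝒜 → Endofunctor 𝒜 → Endofunctor 𝒜
  F ⊕ G = record
    { F₀           = λ X → F₀ F X + F₀ G X
    ; F₁           = λ f → F₁ F f +₁ F₁ G f
    ; identity     = Eq.trans (+₁-resp-≈ (identity F) (identity G)) +₁-id
    ; homomorphism = Eq.trans (+₁-resp-≈ (homomorphism F) (homomorphism G)) +₁-∘
    ; F-resp-≈     = λ p → +₁-resp-≈ (F-resp-≈ F p) (F-resp-≈ G p)
    }

  inl : {F G : Endofunctor 𝒜} → NaturalTransformation F (F ⊕ G)
  inl = record { component = λ _ → i₁ ; natural = λ _ → Eq.sym inject₁ }

  IsSolution : (G : Endofunctor 𝒜) {A X : Obj} (a : F₀ G A ⇒ A) (e : X ⇒ F₀ G X + A) →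
               X ⇒ A → Set q
  IsSolution G a e s = s ≈ [ a , id ] ∘ (F₁ G s +₁ id) ∘ e

  IsCIA : (G : Endofunctor 𝒜) {A : Obj} → F₀ G A ⇒ A → Set (o ⊔ ℓ ⊔ q)
  IsCIA G {A} a = ∀ {X : Obj} (e : X ⇒ F₀ G X + A) → ∃! _≈_ (IsSolution G a e)

  Iteratable : Endofunctor 𝒜 → Set (o ⊔ ℓ ⊔ q)
  Iteratable G = ∀ X → TerminalCoalgebra (G ⊕ Const X)

  module IterationMonad (G : Endofunctor 𝒜) (iteratable : Iteratable G) where
    open HomReasoning
    private module ν (X : Obj) = TerminalCoalgebra (iteratable X)

    T₀ : Obj → Obj
    T₀ X = ν.carrier X

    τ₀ : ∀ X → F₀ G (T₀ X) ⇒ T₀ X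
    τ₀ X = ν.out⁻¹ X ∘ i₁

    η₀ : ∀ X → X ⇒ T₀ X
    η₀ X = ν.out⁻¹ X ∘ i₂

    out-τ : ∀ {X} → ν.out X ∘ τ₀ X ≈ i₁
    out-τ {X} = Eq.trans (pullˡ (ν.out-out⁻¹ X)) identityˡ

    out-η : ∀ {X} → ν.out X ∘ η₀ X ≈ i₂
    out-η {X} = Eq.trans (pullˡ (ν.out-out⁻¹ X)) identityˡ

    [τ,η]-epi : ∀ {X Y} {h k : T₀ X ⇒ Y} →
                h ∘ τ₀ X ≈ k ∘ τ₀ X → h ∘ η₀ X ≈ k ∘ η₀ X → h ≈ k
    [τ,η]-epi {X} p r = ν.out⁻¹-epi X
      (+-ext (Eq.trans assoc (Eq.trans p (Eq.sym assoc)))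
             (Eq.trans assoc (Eq.trans r (Eq.sym assoc))))

    IsHom : ∀ {X Y} → T₀ X ⇒ T₀ Y → Set q
    IsHom {X} {Y} g = g ∘ τ₀ X ≈ τ₀ Y ∘ F₁ G g

    id-hom : ∀ {X} → IsHom (id {T₀ X})
    id-hom = Eq.trans identityˡ (Eq.sym (Eq.trans (∘-congˡ (identity G)) identityʳ))

    ∘-hom : ∀ {X Y Z} {g : T₀ X ⇒ T₀ Y} {h : T₀ Y ⇒ T₀ Z} → IsHom g → IsHom h → IsHom (h ∘ g)
    ∘-hom p r = Eq.trans (pullʳ p) (Eq.trans (pullˡ r) (pullʳ (Eq.sym (homomorphism G))))

    private
      module Extension {X Y : Obj} (f : X ⇒ T₀ Y) where
        F : Endofunctor 𝒜
        F = G ⊕ Const Y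

        c₁ : F₀ G (T₀ X) + X ⇒ F₀ F (T₀ X + T₀ Y)
        c₁ = [ i₁ ∘ F₁ G i₁ , F₁ F i₂ ∘ ν.out Y ∘ f ]

        c : T₀ X + T₀ Y ⇒ F₀ F (T₀ X + T₀ Y)
        c = [ c₁ ∘ ν.out X , F₁ F i₂ ∘ ν.out Y ]

        c-τ : (c ∘ i₁) ∘ τ₀ X ≈ i₁ ∘ F₁ G i₁
        c-τ = begin
          (c ∘ i₁) ∘ τ₀ X         ≈⟨ ∘-congʳ inject₁ ⟩
          (c₁ ∘ ν.out X) ∘ τ₀ X   ≈⟨ pullʳ out-τ ⟩
          c₁ ∘ i₁                 ≈⟨ inject₁ ⟩
          i₁ ∘ F₁ G i₁            ∎

        c-η : (c ∘ i₁) ∘ η₀ X ≈ F₁ F i₂ ∘ ν.out Y ∘ f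
        c-η = begin
          (c ∘ i₁) ∘ η₀ X         ≈⟨ ∘-congʳ inject₁ ⟩
          (c₁ ∘ ν.out X) ∘ η₀ X   ≈⟨ pullʳ out-η ⟩
          c₁ ∘ i₂                 ≈⟨ inject₂ ⟩
          F₁ F i₂ ∘ ν.out Y ∘ f   ∎

        F-i₁ : ∀ {Z} {h : T₀ X + T₀ Y ⇒ Z} → F₁ F h ∘ (i₁ ∘ F₁ G i₁) ≈ i₁ ∘ F₁ G (h ∘ i₁)
        F-i₁ = Eq.trans (pullˡ inject₁) (pullʳ (Eq.sym (homomorphism G)))

        F-i₂ : ∀ {Z W} {h : T₀ X + T₀ Y ⇒ Z} {k : W ⇒ F₀ F (T₀ Y)} →
               F₁ F h ∘ (F₁ F i₂ ∘ k) ≈ F₁ F (h ∘ i₂) ∘ k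
        F-i₂ = pullˡ (Eq.sym (homomorphism F))

        F-id : ∀ {W} {h : T₀ Y ⇒ T₀ Y} {k : W ⇒ F₀ F (T₀ Y)} → h ≈ id → F₁ F h ∘ k ≈ k
        F-id p = Eq.trans (∘-congʳ (Eq.trans (F-resp-≈ F p) (identity F))) identityˡ

        h : T₀ X + T₀ Y ⇒ T₀ Y
        h = ν.unfold Y c

        h-i₂ : h ∘ i₂ ≈ id
        h-i₂ = ν.hom-unique Y
          (begin
            ν.out Y ∘ (h ∘ i₂)             ≈⟨ pullˡ (ν.unfold-hom Y) ⟩
            (F₁ F h ∘ c) ∘ i₂              ≈⟨ pullʳ inject₂ ⟩
            F₁ F h ∘ (F₁ F i₂ ∘ ν.out Y)   ≈⟨ F-i₂ ⟩
            F₁ F (h ∘ i₂) ∘ ν.out Y        ∎)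
          (Eq.trans identityʳ (Eq.sym (F-id Eq.refl)))

        ext : T₀ X ⇒ T₀ Y
        ext = h ∘ i₁

        out-ext : ν.out Y ∘ ext ≈ F₁ F h ∘ (c ∘ i₁)
        out-ext = Eq.trans (pullˡ (ν.unfold-hom Y)) assoc

        ext-η : ext ∘ η₀ X ≈ f
        ext-η = ν.out-mono Y (begin
          ν.out Y ∘ (ext ∘ η₀ X)               ≈⟨ pullˡ out-ext ⟩
          (F₁ F h ∘ (c ∘ i₁)) ∘ η₀ X           ≈⟨ pullʳ c-η ⟩
          F₁ F h ∘ (F₁ F i₂ ∘ (ν.out Y ∘ f))   ≈⟨ F-i₂ ⟩
          F₁ F (h ∘ i₂) ∘ (ν.out Y ∘ f)        ≈⟨ F-id h-i₂ ⟩
          ν.out Y ∘ f                          ∎)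

        ext-τ : IsHom ext
        ext-τ = ν.out-mono Y (begin
          ν.out Y ∘ (ext ∘ τ₀ X)       ≈⟨ pullˡ out-ext ⟩
          (F₁ F h ∘ (c ∘ i₁)) ∘ τ₀ X   ≈⟨ pullʳ c-τ ⟩
          F₁ F h ∘ (i₁ ∘ F₁ G i₁)      ≈⟨ F-i₁ ⟩
          i₁ ∘ F₁ G ext                ≈⟨ pullˡ out-τ ⟨
          ν.out Y ∘ (τ₀ Y ∘ F₁ G ext)  ∎)

        [g,id]-hom : (g : T₀ X ⇒ T₀ Y) → g ∘ η₀ X ≈ f → IsHom g →
                     ν.out Y ∘ [ g , id ] ≈ F₁ F [ g , id ] ∘ c
        [g,id]-hom g p r = +-ext
          (begin
            (ν.out Y ∘ [ g , id ]) ∘ i₁    ≈⟨ pullʳ inject₁ ⟩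
            ν.out Y ∘ g                    ≈⟨ [τ,η]-epi on-τ on-η ⟩
            F₁ F [ g , id ] ∘ (c ∘ i₁)     ≈⟨ assoc ⟨
            (F₁ F [ g , id ] ∘ c) ∘ i₁     ∎)
          (begin
            (ν.out Y ∘ [ g , id ]) ∘ i₂               ≈⟨ pullʳ inject₂ ⟩
            ν.out Y ∘ id                              ≈⟨ identityʳ ⟩
            ν.out Y                                   ≈⟨ F-id inject₂ ⟨
            F₁ F ([ g , id ] ∘ i₂) ∘ ν.out Y          ≈⟨ F-i₂ ⟨
            F₁ F [ g , id ] ∘ (F₁ F i₂ ∘ ν.out Y)     ≈⟨ pullʳ inject₂ ⟨
            (F₁ F [ g , id ] ∘ c) ∘ i₂                ∎)
          where
          on-τ : (ν.out Y ∘ g) ∘ τ₀ X ≈ (F₁ F [ g , id ] ∘ (c ∘ i₁)) ∘ τ₀ X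
          on-τ = begin
            (ν.out Y ∘ g) ∘ τ₀ X                  ≈⟨ pullʳ r ⟩
            ν.out Y ∘ (τ₀ Y ∘ F₁ G g)             ≈⟨ pullˡ out-τ ⟩
            i₁ ∘ F₁ G g                           ≈⟨ ∘-congˡ (F-resp-≈ G inject₁) ⟨
            i₁ ∘ F₁ G ([ g , id ] ∘ i₁)           ≈⟨ F-i₁ ⟨
            F₁ F [ g , id ] ∘ (i₁ ∘ F₁ G i₁)      ≈⟨ pullʳ c-τ ⟨
            (F₁ F [ g , id ] ∘ (c ∘ i₁)) ∘ τ₀ X   ∎

          on-η : (ν.out Y ∘ g) ∘ η₀ X ≈ (F₁ F [ g , id ] ∘ (c ∘ i₁)) ∘ η₀ X
          on-η = begin
            (ν.out Y ∘ g) ∘ η₀ X                          ≈⟨ pullʳ p ⟩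
            ν.out Y ∘ f                                   ≈⟨ F-id inject₂ ⟨
            F₁ F ([ g , id ] ∘ i₂) ∘ (ν.out Y ∘ f)        ≈⟨ F-i₂ ⟨
            F₁ F [ g , id ] ∘ (F₁ F i₂ ∘ (ν.out Y ∘ f))   ≈⟨ pullʳ c-η ⟨
            (F₁ F [ g , id ] ∘ (c ∘ i₁)) ∘ η₀ X           ∎

    -- f ♯ is the unique G-algebra homomorphism extending f along η; the functor
    -- T and the multiplication μ are the ones of this Kleisli triple.
    infix 10 _♯
    _♯ : ∀ {X Y} → X ⇒ T₀ Y → T₀ X ⇒ T₀ Y
    f ♯ = Extension.ext f

    ♯-η : ∀ {X Y} {f : X ⇒ T₀ Y} → f ♯ ∘ η₀ X ≈ f
    ♯-η {f = f} = Extension.ext-η f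

    ♯-hom : ∀ {X Y} {f : X ⇒ T₀ Y} → IsHom (f ♯)
    ♯-hom {f = f} = Extension.ext-τ f

    ♯-unique : ∀ {X Y} {g k : T₀ X ⇒ T₀ Y} → IsHom g → IsHom k → g ∘ η₀ X ≈ k ∘ η₀ X → g ≈ k
    ♯-unique {X} {Y} {g} {k} p r s = begin
      g                 ≈⟨ inject₁ ⟨
      [ g , id ] ∘ i₁   ≈⟨ ∘-congʳ (ν.hom-unique Y ([g,id]-hom g s p) ([g,id]-hom k Eq.refl r)) ⟩
      [ k , id ] ∘ i₁   ≈⟨ inject₁ ⟩
      k                 ∎
      where open Extension (k ∘ η₀ X)

    T : Endofunctor 𝒜
    T = record
      { F₀           = T₀
      ; F₁           = λ {_} {Y} f → (η₀ Y ∘ f) ♯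
      ; identity     = ♯-unique ♯-hom id-hom
                         (Eq.trans ♯-η (Eq.trans identityʳ (Eq.sym identityˡ)))
      ; homomorphism = ♯-unique ♯-hom (∘-hom ♯-hom ♯-hom)
                         (Eq.trans ♯-η (Eq.sym (Eq.trans (pullʳ ♯-η) (Eq.trans (pullˡ ♯-η) assoc))))
      ; F-resp-≈     = λ p → ♯-unique ♯-hom ♯-hom
                         (Eq.trans ♯-η (Eq.trans (∘-congˡ p) (Eq.sym ♯-η)))
      }

    η : NaturalTransformation Id T
    η = record { component = η₀ ; natural = λ _ → Eq.sym ♯-η }

    τ : NaturalTransformation (G ∘F T) T
    τ = record { component = τ₀ ; natural = λ _ → Eq.sym ♯-hom }

    μ : NaturalTransformation (T ∘F T) T
    μ = record
      { component = λ _ → id ♯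
      ; natural   = λ _ → ♯-unique (∘-hom ♯-hom ♯-hom) (∘-hom ♯-hom ♯-hom)
          (Eq.trans (pullʳ ♯-η) (Eq.trans (pullˡ ♯-η)
            (Eq.trans identityˡ (Eq.sym (Eq.trans (pullʳ ♯-η) identityʳ)))))
      }

    monad : Monad 𝒜
    monad = record
      { T       = T
      ; η       = η
      ; μ       = μ
      ; μ-assoc = ♯-unique (∘-hom ♯-hom ♯-hom) (∘-hom ♯-hom ♯-hom)
          (Eq.trans (pullʳ ♯-η) (Eq.trans (pullˡ ♯-η)
            (Eq.trans identityˡ (Eq.sym (Eq.trans (pullʳ ♯-η) identityʳ)))))
      ; μ-unitˡ = ♯-unique (∘-hom ♯-hom ♯-hom) id-hom
          (Eq.trans (pullʳ ♯-η) (pullˡ ♯-η))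
      ; μ-unitʳ = ♯-η
      }

    κ : NaturalTransformation G T
    κ = record
      { component = λ X → component τ X ∘ F₁ G (component η X)
      ; natural   = λ f → begin
          (τ₀ _ ∘ F₁ G (η₀ _)) ∘ F₁ G f          ≈⟨ pullʳ (Eq.sym (homomorphism G)) ⟩
          τ₀ _ ∘ F₁ G (η₀ _ ∘ f)                 ≈⟨ ∘-congˡ (F-resp-≈ G (natural η f)) ⟩
          τ₀ _ ∘ F₁ G (F₁ T f ∘ η₀ _)            ≈⟨ ∘-congˡ (homomorphism G) ⟩
          τ₀ _ ∘ (F₁ G (F₁ T f) ∘ F₁ G (η₀ _))   ≈⟨ pullˡ (natural τ f) ⟩
          (F₁ T f ∘ τ₀ _) ∘ F₁ G (η₀ _)          ≈⟨ assoc ⟩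
          F₁ T f ∘ (τ₀ _ ∘ F₁ G (η₀ _))          ∎
      }

  module RPS (H V : Endofunctor 𝒜) (iteratable : Iteratable (H ⊕ V)) where
    open IterationMonad (H ⊕ V) iteratable

    RecursiveProgramScheme : Set (o ⊔ ℓ ⊔ q)
    RecursiveProgramScheme = NaturalTransformation V T

    Guarded : RecursiveProgramScheme → Set (o ⊔ ℓ ⊔ q)
    Guarded e = Σ (NaturalTransformation V (H ∘F T)) λ f →
      ∀ X → component e X ≈ component τ X ∘ component (inl {H} {V}) (F₀ T X) ∘ component f X

    record IsInterpretedSolution {A : Obj} (a : F₀ H A ⇒ A) (e : RecursiveProgramScheme)
                                 (e‡ : F₀ V A ⇒ A) : Set (ℓ ⊔ q) where
      field
        β                : F₀ T A ⇒ A
        isEilenbergMoore : IsEilenbergMoore monad β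
        β-κ              : β ∘ component κ A ≈ [ a , e‡ ]
        solution         : e‡ ≈ β ∘ component e A

{-# OPTIONS --safe #-}
-- Write G = H + V, b = [ a , e‡ ] and let f : V → H T be the guard of e.  An
-- Eilenberg–Moore algebra β is a G-algebra homomorphism (T A , τ) → (A , b), so
-- composing β with the coinductive solution of a flat equation m : X → G X + A
-- in T A gives a solution in A.  For uniqueness, e‡ = a · H β · f, so for every
-- solution s of m the extension β · T s : T X → A solves a flat equation
-- T X → H T X + A for H that does not depend on s.  As (A , a) is a cia for H,
-- β · T s is determined by m, and so is s = β · T s · η.
module Submission where

open import Level using (Level)
open import Data.Product using (_,_; proj₁; proj₂)
open import Defs

module _ {o ℓ q : Level} (𝒜 : Category o ℓ q) (coproducts : BinaryCoproducts 𝒜) where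
  open Category 𝒜
  open BinaryCoproducts coproducts
  open WithCoproducts 𝒜 coproducts
  open Endofunctor
  open NaturalTransformation
  open HomReasoning

  ∘-[] : ∀ {A B C D} {f : A ⇒ C} {g : B ⇒ C} {h : C ⇒ D} → h ∘ [ f , g ] ≈ [ h ∘ f , h ∘ g ]
  ∘-[] = Eq.sym (unique (pullʳ inject₁) (pullʳ inject₂))

  []-resp-≈ : ∀ {A B C} {f f′ : A ⇒ C} {g g′ : B ⇒ C} → f ≈ f′ → g ≈ g′ → [ f , g ] ≈ [ f′ , g′ ]
  []-resp-≈ p r = unique (Eq.trans inject₁ (Eq.sym p)) (Eq.trans inject₂ (Eq.sym r))

  []-+₁ : ∀ {A B C D E} {f : A ⇒ C} {g : B ⇒ D} {h : C ⇒ E} {k : D ⇒ E} →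
          [ h , k ] ∘ (f +₁ g) ≈ [ h ∘ f , k ∘ g ]
  []-+₁ = Eq.trans ∘-[] ([]-resp-≈ (pullˡ inject₁) (pullˡ inject₂))

  [,id]-+₁ : ∀ {A B C} {f : A ⇒ B} {h : B ⇒ C} → [ h , id ] ∘ (f +₁ id) ≈ [ h ∘ f , id ]
  [,id]-+₁ = Eq.trans []-+₁ ([]-resp-≈ Eq.refl identityˡ)

  -- `IsSolution` with its two factors fused into one copairing, so that later rewriting happens
  -- under a single bracket.
  Solves : (G : Endofunctor 𝒜) {A X : Obj} (a : F₀ G A ⇒ A) (e : X ⇒ F₀ G X + A) → X ⇒ A → Set q
  Solves G a e s = s ≈ [ a ∘ F₁ G s , id ] ∘ e

  Solves⇒IsSolution : ∀ {G A X} {a : F₀ G A ⇒ A} {e : X ⇒ F₀ G X + A} {s : X ⇒ A} →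
                  Solves G a e s → IsSolution G a e s
  Solves⇒IsSolution p = Eq.trans p (Eq.sym (pullˡ [,id]-+₁))

  IsSolution⇒Solves : ∀ {G A X} {a : F₀ G A ⇒ A} {e : X ⇒ F₀ G X + A} {s : X ⇒ A} →
                    IsSolution G a e s → Solves G a e s
  IsSolution⇒Solves p = Eq.trans p (pullˡ [,id]-+₁)

  module EilenbergMoore (G : Endofunctor 𝒜) (iteratable : Iteratable G) {A : Obj}
    (β : F₀ (IterationMonad.T G iteratable) A ⇒ A)
    (isEM : IsEilenbergMoore (IterationMonad.monad G iteratable) β)
    {b : F₀ G A ⇒ A} (β-κ : β ∘ component (IterationMonad.κ G iteratable) A ≈ b) where
    open IterationMonad G iteratable
    open IsEilenbergMoore isEM

    -- Multiplication is a homomorphism and cancels `η`, so `τ` is recovered from `κ`; this carries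
    -- knowledge of `β` on `κ` over to `τ`.
    μ-κ : ∀ {X} → component μ X ∘ component κ (T₀ X) ≈ τ₀ X
    μ-κ {X} = begin
      id ♯ ∘ (τ₀ (T₀ X) ∘ F₁ G (η₀ (T₀ X)))   ≈⟨ pullˡ ♯-hom ⟩
      (τ₀ X ∘ F₁ G (id ♯)) ∘ F₁ G (η₀ (T₀ X)) ≈⟨ pullʳ (Eq.sym (homomorphism G)) ⟩
      τ₀ X ∘ F₁ G (id ♯ ∘ η₀ (T₀ X))          ≈⟨ ∘-congˡ (F-resp-≈ G ♯-η) ⟩
      τ₀ X ∘ F₁ G id                          ≈⟨ ∘-congˡ (identity G) ⟩
      τ₀ X ∘ id                               ≈⟨ identityʳ ⟩
      τ₀ X                                    ∎

    β-hom : β ∘ τ₀ A ≈ b ∘ F₁ G β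
    β-hom = begin
      β ∘ τ₀ A                                ≈⟨ ∘-congˡ μ-κ ⟨
      β ∘ (component μ A ∘ component κ (T₀ A)) ≈⟨ pullˡ mult ⟩
      (β ∘ F₁ T β) ∘ component κ (T₀ A)       ≈⟨ pullʳ (Eq.sym (natural κ β)) ⟩
      β ∘ (component κ A ∘ F₁ G β)            ≈⟨ pullˡ β-κ ⟩
      b ∘ F₁ G β                              ∎

    β-out⁻¹ : β ∘ TerminalCoalgebra.out⁻¹ (iteratable A) ≈ [ b ∘ F₁ G β , id ]
    β-out⁻¹ = Eq.sym (unique (Eq.trans assoc β-hom) (Eq.trans assoc unit))

    -- The morphism of Eilenberg-Moore algebras from the free algebra on `X` to `(A , β)` induced by
    -- `s`.
    extend : ∀ {X} → X ⇒ A → T₀ X ⇒ A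
    extend s = β ∘ F₁ T s

    extend-η : ∀ {X} {s : X ⇒ A} → extend s ∘ η₀ X ≈ s
    extend-η {X} {s} = begin
      (β ∘ F₁ T s) ∘ η₀ X ≈⟨ pullʳ ♯-η ⟩
      β ∘ (η₀ A ∘ s)      ≈⟨ pullˡ unit ⟩
      id ∘ s              ≈⟨ identityˡ ⟩
      s                   ∎

    extend-τ : ∀ {X} {s : X ⇒ A} → extend s ∘ τ₀ X ≈ b ∘ F₁ G (extend s)
    extend-τ {X} {s} = begin
      (β ∘ F₁ T s) ∘ τ₀ X         ≈⟨ pullʳ ♯-hom ⟩
      β ∘ (τ₀ A ∘ F₁ G (F₁ T s))  ≈⟨ pullˡ β-hom ⟩
      (b ∘ F₁ G β) ∘ F₁ G (F₁ T s) ≈⟨ pullʳ (Eq.sym (homomorphism G)) ⟩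
      b ∘ F₁ G (β ∘ F₁ T s)       ∎

    -- Associativity of `β` with naturality of `μ`. It removes the second layer of `T` that
    -- expanding a `V`-node creates.
    extend-extend : ∀ {X} {s : X ⇒ A} → extend (extend s) ≈ extend s ∘ component μ X
    extend-extend {X} {s} = begin
      β ∘ F₁ T (β ∘ F₁ T s)             ≈⟨ ∘-congˡ (homomorphism T) ⟩
      β ∘ (F₁ T β ∘ F₁ T (F₁ T s))      ≈⟨ pullˡ (Eq.sym mult) ⟩
      (β ∘ component μ A) ∘ F₁ T (F₁ T s) ≈⟨ pullʳ (natural μ s) ⟩
      β ∘ (F₁ T s ∘ component μ X)      ≈⟨ assoc ⟨
      (β ∘ F₁ T s) ∘ component μ X      ∎

    module _ {X : Obj} (m : X ⇒ F₀ G X + A) where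
      private
        module νA = TerminalCoalgebra (iteratable A)

        -- A flat equation with parameters in `A` is a coalgebra for `G ⊕ Const A`, so finality of
        -- `T₀ A` solves it there.
        h : X ⇒ T₀ A
        h = νA.unfold m

      solution : X ⇒ A
      solution = β ∘ h

      solution-solves : Solves G b m solution
      solution-solves = begin
        β ∘ h                                         ≈⟨ ∘-congˡ identityˡ ⟨
        -- Inserting `out⁻¹ ∘ out` exposes both the coalgebra law of `h` and the action of `β` on
        -- `[ τ , η ]`.
        β ∘ (id ∘ h)                                  ≈⟨ ∘-congˡ (pullˡ νA.out⁻¹-out) ⟨
        β ∘ (νA.out⁻¹ ∘ (νA.out ∘ h))                 ≈⟨ pullˡ β-out⁻¹ ⟩
        [ b ∘ F₁ G β , id ] ∘ (νA.out ∘ h)            ≈⟨ ∘-congˡ νA.unfold-hom ⟩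
        [ b ∘ F₁ G β , id ] ∘ ((F₁ G h +₁ id) ∘ m)    ≈⟨ pullˡ [,id]-+₁ ⟩
        [ (b ∘ F₁ G β) ∘ F₁ G h , id ] ∘ m            ≈⟨ ∘-congʳ ([]-resp-≈ (pullʳ (Eq.sym (homomorphism G))) Eq.refl) ⟩
        [ b ∘ F₁ G (β ∘ h) , id ] ∘ m                 ∎

  module GuardedScheme (H V : Endofunctor 𝒜) (iteratable : Iteratable (H ⊕ V))
    {A : Obj} (a : F₀ H A ⇒ A) (e : RPS.RecursiveProgramScheme H V iteratable)
    (guarded : RPS.Guarded H V iteratable e)
    (e‡ : F₀ V A ⇒ A) (interpreted : RPS.IsInterpretedSolution H V iteratable a e e‡) where

    open IterationMonad (H ⊕ V) iteratable
    open RPS.IsInterpretedSolution interpreted using (β; isEilenbergMoore; β-κ)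
      renaming (solution to e‡-solution)
    open EilenbergMoore (H ⊕ V) iteratable β isEilenbergMoore β-κ public

    private
      G = H ⊕ V
      f = proj₁ guarded

    [a,e‡]-G : ∀ {X} {s : X ⇒ A} → [ a , e‡ ] ∘ F₁ G s ≈ [ a ∘ F₁ H s , e‡ ∘ F₁ V s ]
    [a,e‡]-G = []-+₁

    -- The guard puts an `H`-operation at the root: `β` turns `τ` into `[ a , e‡ ]`, and `i₁`
    -- selects `a`.
    e‡-guard : e‡ ≈ a ∘ (F₁ H β ∘ component f A)
    e‡-guard = begin
      e‡                                      ≈⟨ e‡-solution ⟩
      β ∘ component e A                       ≈⟨ ∘-congˡ (proj₂ guarded A) ⟩
      β ∘ (τ₀ A ∘ (i₁ ∘ component f A))       ≈⟨ pullˡ β-hom ⟩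
      ([ a , e‡ ] ∘ F₁ G β) ∘ (i₁ ∘ component f A) ≈⟨ pullˡ (Eq.trans (∘-congʳ [a,e‡]-G) inject₁) ⟩
      (a ∘ F₁ H β) ∘ component f A            ≈⟨ assoc ⟩
      a ∘ (F₁ H β ∘ component f A)            ∎

    -- Naturality of `f` moves `s` inside the guard. The right side involves `extend s` rather than
    -- `s`, which is why the equation for `H` needs variables `T₀ X`.
    e‡-V : ∀ {X} {s : X ⇒ A} → e‡ ∘ F₁ V s ≈ (a ∘ F₁ H (extend s)) ∘ component f X
    e‡-V {X} {s} = begin
      e‡ ∘ F₁ V s                                   ≈⟨ ∘-congʳ e‡-guard ⟩
      (a ∘ (F₁ H β ∘ component f A)) ∘ F₁ V s       ≈⟨ pullʳ (pullʳ (natural f s)) ⟩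
      a ∘ (F₁ H β ∘ (F₁ H (F₁ T s) ∘ component f X)) ≈⟨ ∘-congˡ (pullˡ (Eq.sym (homomorphism H))) ⟩
      a ∘ (F₁ H (extend s) ∘ component f X)         ≈⟨ assoc ⟨
      (a ∘ F₁ H (extend s)) ∘ component f X         ∎

    module _ {X : Obj} (m : X ⇒ F₀ G X + A) where
      private
        module νX = TerminalCoalgebra (iteratable X)

      -- Gives every node an `H`-root: `H`-nodes stay, while the guard expands a `V`-node into an
      -- `H`-term over terms over terms, flattened by `μ`.
      unfold-node : F₀ G (T₀ X) ⇒ F₀ H (T₀ X)
      unfold-node = [ id , F₁ H (component μ X) ∘ component f (T₀ X) ]

      -- The same for a flat term over `X`, whose variables `η` embeds as trivial terms.
      unfold-leaf : F₀ G X ⇒ F₀ H (T₀ X)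
      unfold-leaf = [ F₁ H (η₀ X) , component f X ]

      H-equation : T₀ X ⇒ F₀ H (T₀ X) + A
      H-equation = [ i₁ ∘ unfold-node , (unfold-leaf +₁ id) ∘ m ] ∘ νX.out

      -- On the `V`-summand, `e‡-V` at `extend s` yields `extend (extend s)`, which `extend-extend`
      -- matches with the `μ` in `unfold-node`.
      node-eq : ∀ {s : X ⇒ A} →
                [ a , e‡ ] ∘ F₁ G (extend s) ≈ (a ∘ F₁ H (extend s)) ∘ unfold-node
      node-eq {s} = begin
        [ a , e‡ ] ∘ F₁ G (extend s)                       ≈⟨ [a,e‡]-G ⟩
        [ a ∘ F₁ H (extend s) , e‡ ∘ F₁ V (extend s) ]     ≈⟨ []-resp-≈ (Eq.sym identityʳ) V-part ⟩
        [ (a ∘ F₁ H (extend s)) ∘ id , (a ∘ F₁ H (extend s)) ∘ (F₁ H (component μ X) ∘ component f (T₀ X)) ] ≈⟨ ∘-[] ⟨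
        (a ∘ F₁ H (extend s)) ∘ unfold-node                ∎
        where
        V-part : e‡ ∘ F₁ V (extend s) ≈
                 (a ∘ F₁ H (extend s)) ∘ (F₁ H (component μ X) ∘ component f (T₀ X))
        V-part = begin
          e‡ ∘ F₁ V (extend s)                                    ≈⟨ e‡-V ⟩
          (a ∘ F₁ H (extend (extend s))) ∘ component f (T₀ X)     ≈⟨ ∘-congʳ (∘-congˡ (F-resp-≈ H extend-extend)) ⟩
          (a ∘ F₁ H (extend s ∘ component μ X)) ∘ component f (T₀ X) ≈⟨ ∘-congʳ (pullʳ (Eq.sym (homomorphism H))) ⟨
          ((a ∘ F₁ H (extend s)) ∘ F₁ H (component μ X)) ∘ component f (T₀ X) ≈⟨ assoc ⟩
          (a ∘ F₁ H (extend s)) ∘ (F₁ H (component μ X) ∘ component f (T₀ X)) ∎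

      leaf-eq : ∀ {s : X ⇒ A} →
                [ a , e‡ ] ∘ F₁ G s ≈ (a ∘ F₁ H (extend s)) ∘ unfold-leaf
      leaf-eq {s} = begin
        [ a , e‡ ] ∘ F₁ G s                ≈⟨ [a,e‡]-G ⟩
        [ a ∘ F₁ H s , e‡ ∘ F₁ V s ]       ≈⟨ []-resp-≈ H-part e‡-V ⟩
        [ (a ∘ F₁ H (extend s)) ∘ F₁ H (η₀ X) , (a ∘ F₁ H (extend s)) ∘ component f X ] ≈⟨ ∘-[] ⟨
        (a ∘ F₁ H (extend s)) ∘ unfold-leaf ∎
        where
        H-part : a ∘ F₁ H s ≈ (a ∘ F₁ H (extend s)) ∘ F₁ H (η₀ X)
        H-part = begin
          a ∘ F₁ H s                            ≈⟨ ∘-congˡ (F-resp-≈ H extend-η) ⟨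
          a ∘ F₁ H (extend s ∘ η₀ X)            ≈⟨ pullʳ (Eq.sym (homomorphism H)) ⟨
          (a ∘ F₁ H (extend s)) ∘ F₁ H (η₀ X)   ∎

      -- Checked on the jointly epic `τ` and `η`: on nodes by the algebra structure of `A`, on
      -- variables by the equation `m` that `s` satisfies.
      extend-solves : ∀ {s : X ⇒ A} → Solves G [ a , e‡ ] m s → Solves H a H-equation (extend s)
      extend-solves {s} s-solves = [τ,η]-epi
        (begin
          extend s ∘ τ₀ X                      ≈⟨ extend-τ ⟩
          [ a , e‡ ] ∘ F₁ G (extend s)         ≈⟨ node-eq ⟩
          (a ∘ F₁ H (extend s)) ∘ unfold-node  ≈⟨ pullˡ inject₁ ⟨
          Φ ∘ (i₁ ∘ unfold-node)               ≈⟨ ∘-congˡ (Eq.trans (pullʳ out-τ) inject₁) ⟨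
          Φ ∘ (H-equation ∘ τ₀ X)              ≈⟨ assoc ⟨
          (Φ ∘ H-equation) ∘ τ₀ X              ∎)
        (begin
          extend s ∘ η₀ X                      ≈⟨ extend-η ⟩
          s                                    ≈⟨ s-solves ⟩
          [ [ a , e‡ ] ∘ F₁ G s , id ] ∘ m     ≈⟨ ∘-congʳ ([]-resp-≈ leaf-eq Eq.refl) ⟩
          [ (a ∘ F₁ H (extend s)) ∘ unfold-leaf , id ] ∘ m ≈⟨ pullˡ [,id]-+₁ ⟨
          Φ ∘ ((unfold-leaf +₁ id) ∘ m)        ≈⟨ ∘-congˡ (Eq.trans (pullʳ out-η) inject₂) ⟨
          Φ ∘ (H-equation ∘ η₀ X)              ≈⟨ assoc ⟨
          (Φ ∘ H-equation) ∘ η₀ X              ∎)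
        where
        Φ : F₀ H (T₀ X) + A ⇒ A
        Φ = [ a ∘ F₁ H (extend s) , id ]

      solution-unique : IsCIA H a → ∀ {s t : X ⇒ A} →
                        Solves G [ a , e‡ ] m s → Solves G [ a , e‡ ] m t → s ≈ t
      solution-unique cia {s} {t} p r = begin
        s                 ≈⟨ extend-η ⟨
        -- `H-equation` mentions neither `s` nor `t`, so both extensions equal its one solution in
        -- the cia `(A , a)`.
        extend s ∘ η₀ X   ≈⟨ ∘-congʳ (Eq.trans (Eq.sym (†-unique p)) (†-unique r)) ⟩
        extend t ∘ η₀ X   ≈⟨ extend-η ⟩
        t                 ∎
        where
        †-unique : ∀ {s} → Solves G [ a , e‡ ] m s → proj₁ (cia H-equation) ≈ extend s
        †-unique p = proj₂ (proj₂ (cia H-equation)) (Solves⇒IsSolution {H} (extend-solves p))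

mainTheorem4 :
    {o ℓ q : Level} (𝒜 : Category o ℓ q) (coproducts : BinaryCoproducts 𝒜) →
    let
      open Category 𝒜
      open BinaryCoproducts coproducts
      open WithCoproducts 𝒜 coproducts
      open Endofunctor
    in
    (H V : Endofunctor 𝒜) (iteratable : Iteratable (H ⊕ V)) →
    let
      open RPS H V iteratable
    in
    {A : Obj} (a : F₀ H A ⇒ A) → IsCIA H a →
    (e : RecursiveProgramScheme) → Guarded e →
    (e‡ : F₀ V A ⇒ A) → IsInterpretedSolution a e e‡ →
    IsCIA (H ⊕ V) [ a , e‡ ]
mainTheorem4 𝒜 coproducts H V iteratable a cia e guarded e‡ interpreted m =
    solution m
  , Solves⇒IsSolution 𝒜 coproducts {G} (solution-solves m)
  , λ p → solution-unique m cia (solution-solves m) (IsSolution⇒Solves 𝒜 coproducts {G} p)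
  where
  open WithCoproducts 𝒜 coproducts using (_⊕_)
  open GuardedScheme 𝒜 coproducts H V iteratable a e guarded e‡ interpreted
  G = H ⊕ V
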